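{- Let $G$ be a finite simple graph with no isolated vertices that is not isomorphic to any of the following graphs: (1) the cycle $C_6$; (2) the cycle $C_6$ with vertices $x_0,\dots,x_5$ in cyclic order together with the chord $x_0x_2$; (3) the cycle $C_6$ with vertices $x_0,\dots,x_5$ in cyclic order together with the chords $x_0x_2$ and $x_3x_5$; (4) the graph with vertex set $\{r,s,t,u,v,w,x\}$ and edge set $\{rs,tu,rv,uv,rw,tw,sx,tx,ux\}$; (5) for any integers $a,b,c\ge 0$: the graph with vertices $r,s,t,u$ and edges $rs,tu$, together with pairwise disjoint sets $W,X,Y$ of sizes $a,b,c$ such that $W\cup X\cup Y$ is independent, every vertex of $W$ is adjacent exactly to $s,t,u$, every vertex of $X$ exactly to $r,t,u$, and every vertex of $Y$ exactly to $r,s,t,u$; (6) for any integers $a,b,c,d\ge 0$: the graph with vertices $r,s,t,u$ and edges $rs,tu$, together with pairwise disjoint sets $W,X,Y,Z$ of sizes $a,b,c,d$ such that $W\cup X\cup Y\cup Z$ is independent, every vertex of $W$ is adjacent exactly to $s,t$, every vertex of $X$ exactly to $s,u$, every vertex of $Y$ exactly to $s,t,u$, and every vertex of $Z$ exactly to $r,s,t,u$. Then $G$ is $2K_2$-free if and only if $G/e$ is $2K_2$-free for every edge $e\in E(G)$.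
   Context: All graphs are finite and simple. $2K_2$ is the graph consisting of two disjoint edges (four vertices). A graph is $H$-free if it has no induced subgraph isomorphic to $H$. For an edge $e=uv$ of $G$, the contraction $G/e$ is obtained from $G$ by deleting $u$ and $v$ and adding a new vertex adjacent to every vertex of $(N(u)\cup N(v))\setminus\{u,v\}$. -}

module Defs where

open import Data.Nat using (ℕ; zero; suc)
open import Data.Fin using (Fin; zero; suc)
open import Data.Bool using (Bool; true; false; _∨_)
open import Data.Bool.Properties using (∨-comm)
open import Data.Sum using (_⊎_; inj₁; inj₂)
open import Data.Maybe using (Maybe; just; nothing)
open import Data.Product using (Σ; _×_; _,_; ∃)
open import Relation.Binary.PropositionalEquality using (_≡_; _≢_; refl)
open import Relation.Nullary using (¬_)
open import Function.Bundles using (_↔_; Inverse)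
open import Function.Definitions using (Injective)

record Graph : Set₁ where
  field
    V       : Set
    adj     : V → V → Bool
    adj-sym : ∀ x y → adj x y ≡ adj y x
    adj-irr : ∀ x → adj x x ≡ false
open Graph public

Finite : Graph → Set
Finite G = Σ ℕ λ n → V G ↔ Fin n

NoIsolated : Graph → Set
NoIsolated G = ∀ x → ∃ λ y → adj G x y ≡ true

_≅_ : Graph → Graph → Set
G ≅ H = Σ (V G ↔ V H) λ φ →
          ∀ x y → adj H (Inverse.to φ x) (Inverse.to φ y) ≡ adj G x y

mkGraph : (W : Set) (e : W → W → Bool) → (∀ x → e x x ≡ false) → Graph
mkGraph W e e-irr = record
  { V = W
  ; adj = λ x y → e x y ∨ e y x
  ; adj-sym = λ x y → ∨-comm (e x y) (e y x)
  ; adj-irr = irr }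
  where
  irr : ∀ x → e x x ∨ e x x ≡ false
  irr x rewrite e-irr x = refl

adj2K2 : Fin 4 → Fin 4 → Bool
adj2K2 zero (suc zero) = true
adj2K2 (suc zero) zero = true
adj2K2 (suc (suc zero)) (suc (suc (suc zero))) = true
adj2K2 (suc (suc (suc zero))) (suc (suc zero)) = true
adj2K2 _ _ = false

Has2K2 : Graph → Set
Has2K2 G = Σ (Fin 4 → V G) λ f →
             Injective _≡_ _≡_ f × (∀ i j → adj G (f i) (f j) ≡ adj2K2 i j)

2K2-free : Graph → Set
2K2-free G = ¬ Has2K2 G

-- Contraction G / uv : delete u and v, add a new vertex (nothing)
-- adjacent to (N(u) ∪ N(v)) ∖ {u, v}.

record Rest (G : Graph) (u v : V G) : Set where
  constructor rest
  field
    val  : V G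
    .ne₁ : val ≢ u
    .ne₂ : val ≢ v
open Rest public

contract : (G : Graph) (u v : V G) → Graph
contract G u v = record
  { V = Maybe (Rest G u v)
  ; adj = a
  ; adj-sym = s
  ; adj-irr = i }
  where
  a : Maybe (Rest G u v) → Maybe (Rest G u v) → Bool
  a nothing  nothing  = false
  a nothing  (just y) = adj G u (val y) ∨ adj G v (val y)
  a (just x) nothing  = adj G u (val x) ∨ adj G v (val x)
  a (just x) (just y) = adj G (val x) (val y)
  s : ∀ x y → a x y ≡ a y x
  s nothing  nothing  = refl
  s nothing  (just y) = refl
  s (just x) nothing  = refl
  s (just x) (just y) = adj-sym G (val x) (val y)
  i : ∀ x → a x x ≡ false
  i nothing  = refl
  i (just x) = adj-irr G (val x)

-- (1) C₆ on x₀..x₅ = 0..5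
-- (2) C₆ + chord x₀x₂ ; (3) C₆ + chords x₀x₂, x₃x₅
-- directed edge relation, parametrised by which chords are present
c6e : Bool → Bool → Fin 6 → Fin 6 → Bool
c6e _ _ zero (suc zero) = true
c6e _ _ (suc zero) (suc (suc zero)) = true
c6e _ _ (suc (suc zero)) (suc (suc (suc zero))) = true
c6e _ _ (suc (suc (suc zero))) (suc (suc (suc (suc zero)))) = true
c6e _ _ (suc (suc (suc (suc zero)))) (suc (suc (suc (suc (suc zero))))) = true
c6e _ _ (suc (suc (suc (suc (suc zero))))) zero = true
c6e c _ zero (suc (suc zero)) = c
c6e _ d (suc (suc (suc zero))) (suc (suc (suc (suc (suc zero))))) = d
c6e _ _ _ _ = false

c6e-irr : ∀ c d x → c6e c d x x ≡ false
c6e-irr c d zero = refl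
c6e-irr c d (suc zero) = refl
c6e-irr c d (suc (suc zero)) = refl
c6e-irr c d (suc (suc (suc zero))) = refl
c6e-irr c d (suc (suc (suc (suc zero)))) = refl
c6e-irr c d (suc (suc (suc (suc (suc zero))))) = refl

C6 : Graph
C6 = mkGraph (Fin 6) (c6e false false) (c6e-irr false false)

C6-one-chord : Graph
C6-one-chord = mkGraph (Fin 6) (c6e true false) (c6e-irr true false)

C6-two-chords : Graph
C6-two-chords = mkGraph (Fin 6) (c6e true true) (c6e-irr true true)

-- (4) vertices r,s,t,u,v,w,x = 0..6,
-- edges rs, tu, rv, uv, rw, tw, sx, tx, ux
g7e : Fin 7 → Fin 7 → Bool
g7e zero (suc zero) = true                                        -- rs
g7e (suc (suc zero)) (suc (suc (suc zero))) = true                -- tu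
g7e zero (suc (suc (suc (suc zero)))) = true                      -- rv
g7e (suc (suc (suc zero))) (suc (suc (suc (suc zero)))) = true    -- uv
g7e zero (suc (suc (suc (suc (suc zero))))) = true                -- rw
g7e (suc (suc zero)) (suc (suc (suc (suc (suc zero))))) = true    -- tw
g7e (suc zero) (suc (suc (suc (suc (suc (suc zero)))))) = true    -- sx
g7e (suc (suc zero)) (suc (suc (suc (suc (suc (suc zero)))))) = true        -- tx
g7e (suc (suc (suc zero))) (suc (suc (suc (suc (suc (suc zero)))))) = true  -- ux
g7e _ _ = false

g7e-irr : ∀ x → g7e x x ≡ false
g7e-irr zero = refl
g7e-irr (suc zero) = refl
g7e-irr (suc (suc zero)) = refl
g7e-irr (suc (suc (suc zero))) = refl
g7e-irr (suc (suc (suc (suc zero)))) = refl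
g7e-irr (suc (suc (suc (suc (suc zero))))) = refl
g7e-irr (suc (suc (suc (suc (suc (suc zero)))))) = refl

G7 : Graph
G7 = mkGraph (Fin 7) g7e g7e-irr

-- core of families (5),(6): r,s,t,u = 0,1,2,3 with edges rs, tu
coreE : Fin 4 → Fin 4 → Bool
coreE zero (suc zero) = true
coreE (suc (suc zero)) (suc (suc (suc zero))) = true
coreE _ _ = false

coreE-irr : ∀ x → coreE x x ≡ false
coreE-irr zero = refl
coreE-irr (suc zero) = refl
coreE-irr (suc (suc zero)) = refl
coreE-irr (suc (suc (suc zero))) = refl

N-stu N-rtu N-rstu N-st N-su : Fin 4 → Bool
N-stu zero = false
N-stu (suc _) = true
N-rtu (suc zero) = false
N-rtu _ = true
N-rstu _ = true
N-st (suc zero) = true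
N-st (suc (suc zero)) = true
N-st _ = false
N-su (suc zero) = true
N-su (suc (suc (suc zero))) = true
N-su _ = false

-- (5) vertices: core ⊎ W ⊎ X ⊎ Y with |W| = a, |X| = b, |Y| = c
V5 : ℕ → ℕ → ℕ → Set
V5 a b c = Fin 4 ⊎ (Fin a ⊎ (Fin b ⊎ Fin c))

f5e : ∀ a b c → V5 a b c → V5 a b c → Bool
f5e a b c (inj₁ i) (inj₁ j) = coreE i j
f5e a b c (inj₂ (inj₁ _)) (inj₁ j) = N-stu j
f5e a b c (inj₂ (inj₂ (inj₁ _))) (inj₁ j) = N-rtu j
f5e a b c (inj₂ (inj₂ (inj₂ _))) (inj₁ j) = N-rstu j
f5e a b c _ _ = false

f5e-irr : ∀ a b c x → f5e a b c x x ≡ false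
f5e-irr a b c (inj₁ i) = coreE-irr i
f5e-irr a b c (inj₂ (inj₁ _)) = refl
f5e-irr a b c (inj₂ (inj₂ (inj₁ _))) = refl
f5e-irr a b c (inj₂ (inj₂ (inj₂ _))) = refl

F5 : ℕ → ℕ → ℕ → Graph
F5 a b c = mkGraph (V5 a b c) (f5e a b c) (f5e-irr a b c)

-- (6) vertices: core ⊎ W ⊎ X ⊎ Y ⊎ Z with sizes a, b, c, d
V6 : ℕ → ℕ → ℕ → ℕ → Set
V6 a b c d = Fin 4 ⊎ (Fin a ⊎ (Fin b ⊎ (Fin c ⊎ Fin d)))

f6e : ∀ a b c d → V6 a b c d → V6 a b c d → Bool
f6e a b c d (inj₁ i) (inj₁ j) = coreE i j
f6e a b c d (inj₂ (inj₁ _)) (inj₁ j) = N-st j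
f6e a b c d (inj₂ (inj₂ (inj₁ _))) (inj₁ j) = N-su j
f6e a b c d (inj₂ (inj₂ (inj₂ (inj₁ _)))) (inj₁ j) = N-stu j
f6e a b c d (inj₂ (inj₂ (inj₂ (inj₂ _)))) (inj₁ j) = N-rstu j
f6e a b c d _ _ = false

f6e-irr : ∀ a b c d x → f6e a b c d x x ≡ false
f6e-irr a b c d (inj₁ i) = coreE-irr i
f6e-irr a b c d (inj₂ (inj₁ _)) = refl
f6e-irr a b c d (inj₂ (inj₂ (inj₁ _))) = refl
f6e-irr a b c d (inj₂ (inj₂ (inj₂ (inj₁ _)))) = refl
f6e-irr a b c d (inj₂ (inj₂ (inj₂ (inj₂ _)))) = refl

F6 : ℕ → ℕ → ℕ → ℕ → Graph
F6 a b c d = mkGraph (V6 a b c d) (f6e a b c d) (f6e-irr a b c d)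

{-# OPTIONS --safe #-}
module Submission where

open import Defs
open import Data.Nat using (ℕ; zero; suc)
open import Data.Fin using (Fin; zero; suc)
import Data.Fin.Properties as Fin
open import Data.Bool using (Bool; true; false; _∨_)
import Data.Bool.Properties as Bool
open import Data.Sum using (_⊎_; inj₁; inj₂; [_,_]′)
import Data.Sum.Properties as Sum
open import Data.Sum.Function.Propositional using (_⊎-↔_)
open import Data.Maybe using (Maybe; just; nothing)
open import Data.Product using (Σ; ∃; ∃₂; _×_; _,_; proj₁; proj₂)
import Data.Product.Function.Dependent.Propositional as Σ
open import Data.Unit using (⊤; tt)
open import Data.Empty using (⊥; ⊥-elim)
open import Data.Vec using (Vec; []; _∷_; lookup)
open import Data.Vec.Relation.Unary.Any using (here; there; index)
open import Data.Vec.Relation.Unary.Any.Properties using (lookup-index)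
open import Data.Vec.Membership.Propositional using (_∈_; _∉_)
open import Data.Vec.Membership.Propositional.Properties using (∈-lookup)
import Data.Vec.Membership.DecPropositional as DecMembership
open import Relation.Binary.PropositionalEquality
  using (_≡_; _≢_; refl; sym; trans; cong; cong₂)
open import Relation.Binary.Definitions using (DecidableEquality)
open import Relation.Nullary using (¬_; Dec; yes; no; Irrelevant; contradiction)
open import Relation.Nullary.Decidable using (from-yes; _→-dec_)
open import Axiom.UniquenessOfIdentityProofs using (module Decidable⇒UIP)
open import Function using (_∘_; _∘′_; id)
open import Function.Bundles using (_⇔_; _↔_; Inverse; mk↔ₛ′; mk⇔)
open import Function.Construct.Symmetry using (↔-sym)
open import Function.Construct.Composition using (_↔-∘_)
open import Function.Construct.Identity using (↔-id)
open import Function.Properties.Inverse using (↔⇒↣)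

-- Lifting a 2K₂ from G/e to G is direct. Conversely, let every G/e be 2K₂-free and let rs, tu
-- induce a 2K₂ in G. The vertices outside any induced 2K₂ are independent and, as none is
-- isolated, each touches both of its edges; otherwise some contraction would keep a 2K₂.
-- If outside vertices x, y conflict, say x ~ r, x ≁ t, y ~ t, y ≁ r, then xr, yt is a second
-- induced 2K₂, and comparing the two leaves only C₆ with up to two chords or graph (4).
-- Without conflicts some vertex of {r,s,t,u}, say s, is adjacent to all outside vertices. If the
-- outside neighbours of r are also adjacent to t and u, then G is in family (6). Otherwise, up to
-- symmetry, an outside x is adjacent to r, s but not to t, so outside neighbours of t are
-- neighbours of r and s. Then either u is adjacent to every outside vertex and G is in family (6),
-- or some outside y ≁ u forces every outside vertex to be adjacent to r and s: family (5).

-- Adjacency tables of small graphs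

Each : ∀ {n} → (Fin n → Set) → Set
Each {zero}  P = ⊤
Each {suc n} P = P zero × Each (P ∘ suc)

each : ∀ {n} {P : Fin n → Set} → Each P → ∀ i → P i
each (p , ps) zero    = p
each (p , ps) (suc i) = each ps i

-- Only the entries with i < j are listed. Like `Each`, this is a nested product and not a function,
-- so that a concrete adjacency table can be written row by row as a tuple.
Above : ∀ {n} → (Fin n → Fin n → Set) → Set
Above {zero}  P = ⊤
Above {suc n} P = Each (P zero ∘ suc) × Above (λ i j → P (suc i) (suc j))

above : ∀ {n} {P : Fin n → Fin n → Set} →
        (∀ i → P i i) → (∀ i j → P i j → P j i) → Above P → ∀ i j → P i j
above P-refl P-sym (row , rows) zero    zero    = P-refl zero
above P-refl P-sym (row , rows) zero    (suc j) = each row j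
above P-refl P-sym (row , rows) (suc i) zero    = P-sym zero (suc i) (each row i)
above P-refl P-sym (row , rows) (suc i) (suc j) =
  above (P-refl ∘ suc) (λ i j → P-sym (suc i) (suc j)) rows i j

-- On a twin-free graph adjacency-preserving maps are injective, which spares proving that the
-- vertices of a listed copy of C₆ or of graph (4) are distinct.
TwinFree : ∀ {n} → (Fin n → Fin n → Bool) → Set
TwinFree e = ∀ i j → (∀ k → e i k ≡ e j k) → i ≡ j

twinFree? : ∀ {n} (e : Fin n → Fin n → Bool) → Dec (TwinFree e)
twinFree? e = Fin.all? λ i → Fin.all? λ j →
  Fin.all? (λ k → e i k Bool.≟ e j k) →-dec i Fin.≟ j

core-adj : ∀ i j → coreE i j ∨ coreE j i ≡ adj2K2 i j
core-adj = from-yes (Fin.all? λ i → Fin.all? λ j → (coreE i j ∨ coreE j i) Bool.≟ adj2K2 i j)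

-- Induced copies of 2K₂ and their symmetries

module Adjacency (G : Graph) where

  fromTable : ∀ {n} (e : Fin n → Fin n → Bool) (e-irr : ∀ i → e i i ≡ false) (f : Fin n → V G) →
              Above (λ i j → adj G (f i) (f j) ≡ e i j ∨ e j i) →
              ∀ i j → adj G (f i) (f j) ≡ e i j ∨ e j i
  fromTable e e-irr f = above
    (λ i → trans (adj-irr G (f i)) (sym (cong₂ _∨_ (e-irr i) (e-irr i))))
    (λ i j p → trans (adj-sym G (f j) (f i)) (trans p (Bool.∨-comm (e i j) (e j i))))

  twinFree-injective : ∀ {n} {e : Fin n → Fin n → Bool} → TwinFree e → (f : Fin n → V G) →
                       (∀ i j → adj G (f i) (f j) ≡ e i j) → ∀ {i j} → f i ≡ f j → i ≡ j
  twinFree-injective tf f f-adj {i} {j} eq = tf i j λ k →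
    trans (sym (f-adj i k)) (trans (cong (λ x → adj G x (f k)) eq) (f-adj j k))

  twinFree-≅ : ∀ {n} (e : Fin n → Fin n → Bool) (e-irr : ∀ i → e i i ≡ false) →
               TwinFree (λ i j → e i j ∨ e j i) → (vs : Vec (V G) n) → (∀ v → v ∈ vs) →
               Above (λ i j → adj G (lookup vs i) (lookup vs j) ≡ e i j ∨ e j i) →
               G ≅ mkGraph (Fin n) e e-irr
  twinFree-≅ {n} e e-irr tf vs cover table =
    -- The position of a vertex in `vs` is read off its membership proof; twin-freeness makes that
    -- position unique.
    mk↔ₛ′ num (lookup vs) (λ i → twinFree-injective tf (lookup vs) f-adj (lookup-num (lookup vs i)))
      lookup-num ,
    λ x y → trans (sym (f-adj (num x) (num y))) (cong₂ (adj G) (lookup-num x) (lookup-num y))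
    where
    num : V G → Fin n
    num v = index (cover v)
    lookup-num : ∀ v → lookup vs (num v) ≡ v
    lookup-num v = sym (lookup-index (cover v))
    f-adj : ∀ i j → adj G (lookup vs i) (lookup vs j) ≡ e i j ∨ e j i
    f-adj = fromTable e e-irr (lookup vs) table

  infix 4 _~_ _≁_

  _~_ _≁_ : V G → V G → Set
  x ~ y = adj G x y ≡ true
  x ≁ y = adj G x y ≡ false

  -- These six adjacencies already make r, s, t, u distinct: no two vertices of 2K₂ have the same
  -- neighbours (`induced-injective`).
  record Induced2K2 (r s t u : V G) : Set where
    constructor induced
    field
      r~s : r ~ s
      t~u : t ~ u
      r≁t : r ≁ t
      r≁u : r ≁ u
      s≁t : s ≁ t
      s≁u : s ≁ u

  ~-sym : ∀ {x y} → x ~ y → y ~ x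
  ~-sym {x} {y} = trans (adj-sym G y x)

  ≁-sym : ∀ {x y} → x ≁ y → y ≁ x
  ≁-sym {x} {y} = trans (adj-sym G y x)

  ~⇒≢ : ∀ {x y z} → x ~ z → y ≁ z → x ≢ y
  ~⇒≢ x~z y≁z refl with trans (sym x~z) y≁z
  ... | ()

  ≁-¬~ : ∀ {x y} → x ~ y → x ≁ y → ⊥
  ≁-¬~ p q = ~⇒≢ p q refl

  flipˡ : ∀ {r s t u} → Induced2K2 r s t u → Induced2K2 s r t u
  flipˡ (induced rs tu rt ru st su) = induced (~-sym rs) tu st su rt ru

  flipʳ : ∀ {r s t u} → Induced2K2 r s t u → Induced2K2 r s u t
  flipʳ (induced rs tu rt ru st su) = induced rs (~-sym tu) ru rt su st

  swap : ∀ {r s t u} → Induced2K2 r s t u → Induced2K2 t u r s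
  swap (induced rs tu rt ru st su) = induced tu rs (≁-sym rt) (≁-sym st) (≁-sym ru) (≁-sym su)

  r≢t : ∀ {r s t u} → Induced2K2 r s t u → r ≢ t
  r≢t (induced rs tu rt ru st su) = ~⇒≢ rs (≁-sym st)

  core : V G → V G → V G → V G → Vec (V G) 4
  core r s t u = r ∷ s ∷ t ∷ u ∷ []

  Outside : V G → V G → V G → V G → V G → Set
  Outside r s t u v = v ∉ core r s t u

  induced-adj : ∀ {r s t u} → Induced2K2 r s t u → ∀ i j →
                adj G (lookup (core r s t u) i) (lookup (core r s t u) j) ≡ coreE i j ∨ coreE j i
  induced-adj {r} {s} {t} {u} (induced rs tu rt ru st su) =
    fromTable coreE coreE-irr (lookup (core r s t u)) ((rs , rt , ru , tt) , (st , su , tt) , (tu , tt) , tt , tt)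

  induced-injective : ∀ {r s t u} → Induced2K2 r s t u → ∀ {i j} →
                      lookup (core r s t u) i ≡ lookup (core r s t u) j → i ≡ j
  induced-injective q = twinFree-injective (from-yes (twinFree? λ i j → coreE i j ∨ coreE j i)) _ (induced-adj q)

  induced⇒has : ∀ {r s t u} → Induced2K2 r s t u → Has2K2 G
  induced⇒has {r} {s} {t} {u} q =
    lookup (core r s t u) , induced-injective q , λ i j → trans (induced-adj q i j) (core-adj i j)

  has⇒induced : Has2K2 G → ∃₂ λ r s → ∃₂ λ t u → Induced2K2 r s t u
  has⇒induced (f , _ , f-adj) = f a , f b , f c , f d ,
    induced (f-adj a b) (f-adj c d) (f-adj a c) (f-adj a d) (f-adj b c) (f-adj b d)
    where
    a b c d : Fin 4
    a = zero
    b = suc zero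
    c = suc (suc zero)
    d = suc (suc (suc zero))

-- Lifting a 2K₂ from a contraction

module Lift (G : Graph) {u v : V G} (u~v : adj G u v ≡ true) where

  private
    C : Graph
    C = contract G u v
    module C = Adjacency C
  open Adjacency G

  Represents : V C → V G → Set
  Represents nothing  w = w ≡ u ⊎ w ≡ v
  Represents (just x) w = w ≡ val x

  ∨-true : ∀ {a b} → a ∨ b ≡ true → a ≡ true ⊎ b ≡ true
  ∨-true {true}  p = inj₁ refl
  ∨-true {false} p = inj₂ p

  ∨-false : ∀ {a b} → a ∨ b ≡ false → a ≡ false × b ≡ false
  ∨-false {false} p = refl , p

  lift-edge : ∀ a b → adj C a b ≡ true →
              ∃₂ λ x y → Represents a x × Represents b y × x ~ y
  lift-edge (just x) (just y) p = val x , val y , refl , refl , p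
  lift-edge nothing  (just y) p with ∨-true p
  ... | inj₁ q = u , val y , inj₁ refl , refl , q
  ... | inj₂ q = v , val y , inj₂ refl , refl , q
  lift-edge (just x) nothing  p with ∨-true p
  ... | inj₁ q = val x , u , refl , inj₁ refl , ~-sym q
  ... | inj₂ q = val x , v , refl , inj₂ refl , ~-sym q

  -- A non-edge at the contracted vertex is a non-edge at both of its ends, so whichever end
  -- `lift-edge` picked will do. The premise `a ≢ b` excludes the pair u, v itself, which is
  -- adjacent in G.
  lift-nonedge : ∀ a b → a ≢ b → adj C a b ≡ false →
                 ∀ {x y} → Represents a x → Represents b y → x ≁ y
  lift-nonedge nothing  nothing  a≢b p _ _ = contradiction refl a≢b
  lift-nonedge (just x) (just y) a≢b p refl refl = p
  lift-nonedge nothing  (just y) a≢b p (inj₁ refl) refl = proj₁ (∨-false p)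
  lift-nonedge nothing  (just y) a≢b p (inj₂ refl) refl = proj₂ (∨-false p)
  lift-nonedge (just x) nothing  a≢b p refl (inj₁ refl) = ≁-sym (proj₁ (∨-false p))
  lift-nonedge (just x) nothing  a≢b p refl (inj₂ refl) = ≁-sym (proj₂ (∨-false p))

  lift-2K2 : ∀ {a b c d} → C.Induced2K2 a b c d → Has2K2 G
  lift-2K2 {a} {b} {c} {d} q@(C.induced ab cd ac ad bc bd)
    with lift-edge a b ab | lift-edge c d cd
  ... | x , y , a∋x , b∋y , x~y | z , w , c∋z , d∋w , z~w = induced⇒has (induced x~y z~w
    (lift-nonedge a c (C.r≢t q) ac a∋x c∋z)
    (lift-nonedge a d (C.r≢t (C.flipʳ q)) ad a∋x d∋w)
    (lift-nonedge b c (C.r≢t (C.flipˡ q)) bc b∋y c∋z)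
    (lift-nonedge b d (C.r≢t (C.flipˡ (C.flipʳ q))) bd b∋y d∋w))

contract-2K2-free : (G : Graph) → 2K2-free G →
                    ∀ u v → adj G u v ≡ true → 2K2-free (contract G u v)
contract-2K2-free G free u v u~v has with Adjacency.has⇒induced (contract G u v) has
... | _ , _ , _ , _ , q = free (Lift.lift-2K2 G u~v q)

-- Finite fibres and blow-ups of a core

subset-finite : ∀ n (P : Fin n → Set) → (∀ i → Dec (P i)) → (∀ i → Irrelevant (P i)) →
                ∃ λ m → Σ (Fin n) P ↔ Fin m
subset-finite zero    P P? P-irr = 0 , mk↔ₛ′ (λ ()) (λ ()) (λ ()) (λ ())
subset-finite (suc n) P P? P-irr with subset-finite n (P ∘ suc) (P? ∘ suc) (P-irr ∘ suc) | P? zero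
... | m , φ | yes p = suc m , mk↔ₛ′ to from to∘from from∘to
  where
  open Inverse φ using () renaming (to to φ⃗; from to φ⃖)
  to : Σ (Fin (suc n)) P → Fin (suc m)
  to (zero , _)  = zero
  to (suc i , q) = suc (φ⃗ (i , q))
  from : Fin (suc m) → Σ (Fin (suc n)) P
  from zero    = zero , p
  from (suc k) = suc (proj₁ (φ⃖ k)) , proj₂ (φ⃖ k)
  to∘from : ∀ k → to (from k) ≡ k
  to∘from zero    = refl
  to∘from (suc k) = cong suc (Inverse.strictlyInverseˡ φ k)
  from∘to : ∀ x → from (to x) ≡ x
  from∘to (zero , q)  = cong (zero ,_) (P-irr zero p q)
  from∘to (suc i , q) = cong (λ x → suc (proj₁ x) , proj₂ x) (Inverse.strictlyInverseʳ φ (i , q))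
... | m , φ | no ¬p = m , mk↔ₛ′ to from (Inverse.strictlyInverseˡ φ) from∘to
  where
  to : Σ (Fin (suc n)) P → Fin m
  to (zero , q)  = contradiction q ¬p
  to (suc i , q) = Inverse.to φ (i , q)
  from : Fin m → Σ (Fin (suc n)) P
  from k = suc (proj₁ (Inverse.from φ k)) , proj₂ (Inverse.from φ k)
  from∘to : ∀ x → from (to x) ≡ x
  from∘to (zero , q)  = contradiction q ¬p
  from∘to (suc i , q) = cong (λ x → suc (proj₁ x) , proj₂ x) (Inverse.strictlyInverseʳ φ (i , q))

-- Decidable equality on B makes proofs of `f a ≡ b` unique (Hedberg), so the fibre counts elements
-- of A and not equality proofs.
fibre-finite : {A B : Set} {n : ℕ} → A ↔ Fin n → DecidableEquality B → (f : A → B) →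
               ∀ b → ∃ λ m → (Σ A λ a → f a ≡ b) ↔ Fin m
fibre-finite {n = n} φ _≟_ f b
  with subset-finite n (λ i → f (Inverse.from φ i) ≡ b) (λ i → f (Inverse.from φ i) ≟ b)
                     (λ i → Decidable⇒UIP.≡-irrelevant _≟_)
... | m , ψ = m , ↔-sym (Σ.cong (↔-sym φ) (↔-id _) ↔-∘ ↔-sym ψ)

-- The fibres of class supply the sizes a, b, c, d of the families (5) and (6).
module BlowUp (G : Graph) {n : ℕ} (finite : V G ↔ Fin n) {r s t u : V G}
              (q : Adjacency.Induced2K2 G r s t u)
              (independent : ∀ {x y} → Adjacency.Outside G r s t u x → Adjacency.Outside G r s t u y →
                             adj G x y ≡ false)
              {k : ℕ} (class : V G → Fin k) (N : Fin k → Fin 4 → Bool)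
              (class-adj : ∀ {x} → Adjacency.Outside G r s t u x →
                           ∀ i → adj G x (lookup (Adjacency.core G r s t u) i) ≡ N (class x) i)
  where

  open Adjacency G

  private
    c : Vec (V G) 4
    c = core r s t u

    _≟_ : DecidableEquality (V G)
    _≟_ = Fin.inj⇒≟ (↔⇒↣ finite)

    open DecMembership _≟_ using (_∈?_)

  kind′ : ∀ v → Dec (v ∈ c) → Fin 4 ⊎ Fin k
  kind′ v (yes v∈c) = inj₁ (index v∈c)
  kind′ v (no  v∉c) = inj₂ (class v)

  kind : V G → Fin 4 ⊎ Fin k
  kind v = kind′ v (v ∈? c)

  kind-core : ∀ v i → kind v ≡ inj₁ i → v ≡ lookup c i
  kind-core v i eq with v ∈? c
  kind-core v i refl | yes v∈c = lookup-index v∈c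

  core-kind : ∀ i → kind (lookup c i) ≡ inj₁ i
  core-kind i with lookup c i ∈? c
  ... | yes v∈c = cong inj₁ (induced-injective q (sym (lookup-index v∈c)))
  ... | no  v∉c = contradiction (∈-lookup i c) v∉c

  kind-outside : ∀ v j → kind v ≡ inj₂ j → v ∉ c × class v ≡ j
  kind-outside v j eq with v ∈? c
  kind-outside v j refl | no v∉c = v∉c , refl

  fibre : ∀ κ → ∃ λ m → (Σ (V G) λ v → kind v ≡ κ) ↔ Fin m
  fibre = fibre-finite finite (Sum.≡-dec Fin._≟_ Fin._≟_) kind

  size : Fin k → ℕ
  size j = proj₁ (fibre (inj₂ j))

  member : ∀ j → Fin (size j) → Σ (V G) λ v → kind v ≡ inj₂ j
  member j = Inverse.from (proj₂ (fibre (inj₂ j)))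

  Numbers : Set
  Numbers = Fin 4 ⊎ Σ (Fin k) (Fin ∘ size)

  -- The value `κ` and its equation are separate arguments so that `along` can replace `kind v` by
  -- an equal value by matching on `refl`.
  number : ∀ v κ → kind v ≡ κ → Numbers
  number v (inj₁ i) eq = inj₁ i
  number v (inj₂ j) eq = inj₂ (j , Inverse.to (proj₂ (fibre (inj₂ j))) (v , eq))

  vertex : Numbers → V G
  vertex (inj₁ i)       = lookup c i
  vertex (inj₂ (j , m)) = proj₁ (member j m)

  vertex-number : ∀ v κ eq → vertex (number v κ eq) ≡ v
  vertex-number v (inj₁ i) eq = sym (kind-core v i eq)
  vertex-number v (inj₂ j) eq =
    cong proj₁ (Inverse.strictlyInverseʳ (proj₂ (fibre (inj₂ j))) (v , eq))

  number-vertex : ∀ p → number (vertex p) (kind (vertex p)) refl ≡ p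
  number-vertex (inj₁ i) = along (core-kind i)
    where
    along : ∀ {κ} → κ ≡ inj₁ i → ∀ {eq} → number (lookup c i) κ eq ≡ inj₁ i
    along refl = refl
  number-vertex (inj₂ (j , m)) = trans (along (proj₂ (member j m)))
    (cong (inj₂ ∘′ (j ,_)) (Inverse.strictlyInverseˡ (proj₂ (fibre (inj₂ j))) m))
    where
    v = vertex (inj₂ (j , m))
    along : ∀ {κ} (eq : kind v ≡ κ) → number v (kind v) refl ≡ number v κ eq
    along refl = refl

  numbering : V G ↔ Numbers
  numbering = mk↔ₛ′ (λ v → number v (kind v) refl) vertex number-vertex (λ v → vertex-number v (kind v) refl)

  -- The relation `e` is one-sided, as in `f5e` and `f6e`: edges between core and outside are listed
  -- from the outside end only, and `mkGraph` symmetrises them.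
  module _ {W : Set} (outer : W ↔ Σ (Fin k) (Fin ∘ size))
           (e : Fin 4 ⊎ W → Fin 4 ⊎ W → Bool) (e-irr : ∀ x → e x x ≡ false)
           (e-core : ∀ i j → e (inj₁ i) (inj₁ j) ≡ coreE i j)
           (e-in   : ∀ i w → e (inj₁ i) (inj₂ w) ≡ false)
           (e-out  : ∀ w i → e (inj₂ w) (inj₁ i) ≡ N (proj₁ (Inverse.to outer w)) i)
           (e-indep : ∀ w w′ → e (inj₂ w) (inj₂ w′) ≡ false)
    where

    bijection : V G ↔ (Fin 4 ⊎ W)
    bijection = (↔-id _ ⊎-↔ ↔-sym outer) ↔-∘ numbering

    private
      point : Fin 4 ⊎ W → V G
      point = Inverse.from bijection

      outside : ∀ w → point (inj₂ w) ∉ c × class (point (inj₂ w)) ≡ proj₁ (Inverse.to outer w)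
      outside w = kind-outside _ _ (proj₂ (member (proj₁ (Inverse.to outer w)) (proj₂ (Inverse.to outer w))))

      outer-core : ∀ w i → adj G (point (inj₂ w)) (lookup c i) ≡ e (inj₂ w) (inj₁ i) ∨ e (inj₁ i) (inj₂ w)
      outer-core w i = trans (class-adj (proj₁ (outside w)) i)
        (trans (cong (λ j → N j i) (proj₂ (outside w)))
        (sym (trans (cong₂ _∨_ (e-out w i) (e-in i w)) (Bool.∨-identityʳ _))))

      point-adj : ∀ x y → adj G (point x) (point y) ≡ e x y ∨ e y x
      point-adj (inj₁ i) (inj₁ j) =
        trans (induced-adj q i j) (sym (cong₂ _∨_ (e-core i j) (e-core j i)))
      point-adj (inj₁ i) (inj₂ w) =
        trans (adj-sym G _ _) (trans (outer-core w i) (Bool.∨-comm (e (inj₂ w) (inj₁ i)) _))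
      point-adj (inj₂ w) (inj₁ i) = outer-core w i
      point-adj (inj₂ w) (inj₂ w′) =
        trans (independent (proj₁ (outside w)) (proj₁ (outside w′)))
              (sym (cong₂ _∨_ (e-indep w w′) (e-indep w′ w)))

    blowUp-≅ : G ≅ mkGraph (Fin 4 ⊎ W) e e-irr
    blowUp-≅ = bijection , λ x y →
      trans (sym (point-adj (Inverse.to bijection x) (Inverse.to bijection y)))
            (cong₂ (adj G) (Inverse.strictlyInverseʳ bijection x) (Inverse.strictlyInverseʳ bijection y))

-- Reconciles the nested sums in the vertex sets of the families with the class-indexed sum that
-- `BlowUp` produces.
sum₃ : (size : Fin 3 → ℕ) →
       (Fin (size zero) ⊎ (Fin (size (suc zero)) ⊎ Fin (size (suc (suc zero))))) ↔ Σ (Fin 3) (Fin ∘ size)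
sum₃ size = mk↔ₛ′
  (λ { (inj₁ m)        → zero , m
     ; (inj₂ (inj₁ m)) → suc zero , m
     ; (inj₂ (inj₂ m)) → suc (suc zero) , m })
  (λ { (zero , m)           → inj₁ m
     ; (suc zero , m)       → inj₂ (inj₁ m)
     ; (suc (suc zero) , m) → inj₂ (inj₂ m) })
  (λ { (zero , m) → refl ; (suc zero , m) → refl ; (suc (suc zero) , m) → refl })
  (λ { (inj₁ m) → refl ; (inj₂ (inj₁ m)) → refl ; (inj₂ (inj₂ m)) → refl })

sum₄ : (size : Fin 4 → ℕ) →
       (Fin (size zero) ⊎ (Fin (size (suc zero)) ⊎
         (Fin (size (suc (suc zero))) ⊎ Fin (size (suc (suc (suc zero))))))) ↔ Σ (Fin 4) (Fin ∘ size)
sum₄ size = mk↔ₛ′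
  (λ { (inj₁ m)               → zero , m
     ; (inj₂ (inj₁ m))        → suc zero , m
     ; (inj₂ (inj₂ (inj₁ m))) → suc (suc zero) , m
     ; (inj₂ (inj₂ (inj₂ m))) → suc (suc (suc zero)) , m })
  (λ { (zero , m)                 → inj₁ m
     ; (suc zero , m)             → inj₂ (inj₁ m)
     ; (suc (suc zero) , m)       → inj₂ (inj₂ (inj₁ m))
     ; (suc (suc (suc zero)) , m) → inj₂ (inj₂ (inj₂ m)) })
  (λ { (zero , m) → refl ; (suc zero , m) → refl
     ; (suc (suc zero) , m) → refl ; (suc (suc (suc zero)) , m) → refl })
  (λ { (inj₁ m) → refl ; (inj₂ (inj₁ m)) → refl
     ; (inj₂ (inj₂ (inj₁ m))) → refl ; (inj₂ (inj₂ (inj₂ m))) → refl })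

-- Recognising families (5) and (6)

module Families (G : Graph) {n : ℕ} (finite : V G ↔ Fin n) {r s t u : V G}
                (q : Adjacency.Induced2K2 G r s t u)
                (independent : ∀ {x y} → Adjacency.Outside G r s t u x → Adjacency.Outside G r s t u y →
                               adj G x y ≡ false)
  where

  open Adjacency G

  -- class₅ reads the adjacencies to r, s and class₆ those to r, t, u. An outside vertex touches
  -- both rs and tu, so the values at false, false and at false, false, false are junk.
  class₅ : Bool → Bool → Fin 3
  class₅ false true  = zero
  class₅ true  false = suc zero
  class₅ _     _     = suc (suc zero)

  N₅ : Fin 3 → Fin 4 → Bool
  N₅ zero             = N-stu
  N₅ (suc zero)       = N-rtu
  N₅ (suc (suc zero)) = N-rstu

  -- Once t and u are common neighbours, only the adjacencies to r and s vary; the three pairs that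
  -- touch rs give W, X and Y.
  in-F5 : (∀ {x} → Outside r s t u x → x ≁ r → x ~ s) →
          (∀ {x} → Outside r s t u x → x ~ t × x ~ u) →
          ∃ λ a → ∃₂ λ b c → G ≅ F5 a b c
  in-F5 touch full = size zero , size (suc zero) , size (suc (suc zero)) ,
    blowUp-≅ (sum₃ size) (f5e _ _ _) (f5e-irr _ _ _) (λ i j → refl) (λ i w → refl)
      (λ { (inj₁ w)        i → refl
         ; (inj₂ (inj₁ w)) i → refl
         ; (inj₂ (inj₂ w)) i → refl })
      (λ { (inj₁ w)        w′ → refl
         ; (inj₂ (inj₁ w)) w′ → refl
         ; (inj₂ (inj₂ w)) w′ → refl })
    where
    class : V G → Fin 3
    class x = class₅ (adj G x r) (adj G x s)

    row : ∀ {x} → Outside r s t u x → ∀ b b′ → adj G x r ≡ b → adj G x s ≡ b′ →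
          Each (λ i → adj G x (lookup (core r s t u) i) ≡ N₅ (class₅ b b′) i)
    row ox true  true  xr xs = xr , xs , proj₁ (full ox) , proj₂ (full ox) , tt
    row ox true  false xr xs = xr , xs , proj₁ (full ox) , proj₂ (full ox) , tt
    row ox false true  xr xs = xr , xs , proj₁ (full ox) , proj₂ (full ox) , tt
    row ox false false xr xs = ⊥-elim (≁-¬~ (touch ox xr) xs)

    open BlowUp G finite q independent class N₅ (λ ox → each (row ox _ _ refl refl))

  class₆ : Bool → Bool → Bool → Fin 4
  class₆ true  _     _     = suc (suc (suc zero))
  class₆ false true  false = zero
  class₆ false false true  = suc zero
  class₆ false _     _     = suc (suc zero)

  N₆ : Fin 4 → Fin 4 → Bool
  N₆ zero                   = N-st
  N₆ (suc zero)             = N-su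
  N₆ (suc (suc zero))       = N-stu
  N₆ (suc (suc (suc zero))) = N-rstu

  -- With s a common neighbour, an outside vertex either sees r, and then the whole core (Z), or
  -- sees besides s a nonempty subset of {t, u} (W, X, Y).
  in-F6 : (∀ {x} → Outside r s t u x → x ≁ t → x ~ u) →
          (∀ {x} → Outside r s t u x → x ~ s) →
          (∀ {x} → Outside r s t u x → x ~ r → x ~ t × x ~ u) →
          ∃₂ λ a b → ∃₂ λ c d → G ≅ F6 a b c d
  in-F6 touch centre full =
    size zero , size (suc zero) , size (suc (suc zero)) , size (suc (suc (suc zero))) ,
    blowUp-≅ (sum₄ size) (f6e _ _ _ _) (f6e-irr _ _ _ _) (λ i j → refl) (λ i w → refl)
      (λ { (inj₁ w)               i → refl
         ; (inj₂ (inj₁ w))        i → refl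
         ; (inj₂ (inj₂ (inj₁ w))) i → refl
         ; (inj₂ (inj₂ (inj₂ w))) i → refl })
      (λ { (inj₁ w)               w′ → refl
         ; (inj₂ (inj₁ w))        w′ → refl
         ; (inj₂ (inj₂ (inj₁ w))) w′ → refl
         ; (inj₂ (inj₂ (inj₂ w))) w′ → refl })
    where
    class : V G → Fin 4
    class x = class₆ (adj G x r) (adj G x t) (adj G x u)

    row : ∀ {x} → Outside r s t u x → ∀ b b′ b″ → adj G x r ≡ b → adj G x t ≡ b′ → adj G x u ≡ b″ →
          Each (λ i → adj G x (lookup (core r s t u) i) ≡ N₆ (class₆ b b′ b″) i)
    row ox true  _     _     xr xt xu = xr , centre ox , proj₁ (full ox xr) , proj₂ (full ox xr) , tt
    row ox false true  true  xr xt xu = xr , centre ox , xt , xu , tt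
    row ox false true  false xr xt xu = xr , centre ox , xt , xu , tt
    row ox false false true  xr xt xu = xr , centre ox , xt , xu , tt
    row ox false false false xr xt xu = ⊥-elim (≁-¬~ (touch ox xt) xu)

    open BlowUp G finite q independent class N₆ (λ ox → each (row ox _ _ _ refl refl refl))

-- Vertices outside an induced 2K₂

module _ {A : Set} {v a b c d : A} where

  ∉⁺ : v ≢ a → v ≢ b → v ≢ c → v ≢ d → v ∉ a ∷ b ∷ c ∷ d ∷ []
  ∉⁺ p₁ p₂ p₃ p₄ (here e)                         = p₁ e
  ∉⁺ p₁ p₂ p₃ p₄ (there (here e))                 = p₂ e
  ∉⁺ p₁ p₂ p₃ p₄ (there (there (here e)))         = p₃ e
  ∉⁺ p₁ p₂ p₃ p₄ (there (there (there (here e)))) = p₄ e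

∉⇒≢ : {A : Set} {n : ℕ} {v : A} {vs : Vec A n} → v ∉ vs → ∀ i → v ≢ lookup vs i
∉⇒≢ {vs = vs} v∉vs i refl = v∉vs (∈-lookup i vs)

module Irreducible (G : Graph) {n : ℕ} (finite : V G ↔ Fin n) (no-isolated : NoIsolated G)
                   (free : ∀ (u v : V G) → adj G u v ≡ true → 2K2-free (contract G u v)) where

  open Adjacency G

  private
    infix 4 _≟_
    _≟_ : DecidableEquality (V G)
    _≟_ = Fin.inj⇒≟ (↔⇒↣ finite)

    open DecMembership _≟_ using (_∈?_)

    adj? : ∀ x y → x ~ y ⊎ x ≁ y
    adj? x y with adj G x y
    ... | true  = inj₁ refl
    ... | false = inj₂ refl

    ¬≁⇒~ : ∀ {x y} → ¬ (x ≁ y) → x ~ y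
    ¬≁⇒~ {x} {y} f = [ id , ⊥-elim ∘ f ]′ (adj? x y)

    ¬~⇒≁ : ∀ {x y} → ¬ (x ~ y) → x ≁ y
    ¬~⇒≁ {x} {y} f = [ ⊥-elim ∘ f , id ]′ (adj? x y)

  out-flipʳ : ∀ {r s t u v} → Outside r s t u v → Outside r s u t v
  out-flipʳ o = ∉⁺ (∉⇒≢ o zero) (∉⇒≢ o (suc zero)) (∉⇒≢ o (suc (suc (suc zero)))) (∉⇒≢ o (suc (suc zero)))

  out-swap : ∀ {r s t u v} → Outside r s t u v → Outside t u r s v
  out-swap o = ∉⁺ (∉⇒≢ o (suc (suc zero))) (∉⇒≢ o (suc (suc (suc zero)))) (∉⇒≢ o zero) (∉⇒≢ o (suc zero))

  out-flipˡ : ∀ {r s t u v} → Outside r s t u v → Outside s r t u v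
  out-flipˡ = out-swap ∘ out-flipʳ ∘ out-swap

  -- Contracting an edge xy that avoids the 2K₂ would leave rs and tu intact and induced.
  independent : ∀ {r s t u x y} → Induced2K2 r s t u → Outside r s t u x → Outside r s t u y → x ≁ y
  independent {r} {s} {t} {u} {x} {y} (induced rs tu rt ru st su) ox oy with adj? x y
  ... | inj₂ x≁y = x≁y
  ... | inj₁ x~y = ⊥-elim (free x y x~y (Adjacency.induced⇒has (contract G x y)
          {just (kept zero)} {just (kept (suc zero))}
          {just (kept (suc (suc zero)))} {just (kept (suc (suc (suc zero))))}
          (Adjacency.induced rs tu rt ru st su)))
    where
    kept : ∀ i → Rest G x y
    kept i = rest (lookup (core r s t u) i) (∉⇒≢ ox i ∘ sym) (∉⇒≢ oy i ∘ sym)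

  -- If x had neighbours only on tu, contracting xt would leave rs and the image of tu induced.
  no-edge-to-t : ∀ {r s t u x} → Induced2K2 r s t u → Outside r s t u x → x ≁ r → x ≁ s → x ~ t → ⊥
  no-edge-to-t {r} {s} {t} {u} {x} q@(induced rs tu rt ru st su) ox x≁r x≁s x~t =
    free x t x~t (Adjacency.induced⇒has (contract G x t)
      {just (rest r (∉⇒≢ ox zero ∘ sym) (r≢t q))}
      {just (rest s (∉⇒≢ ox (suc zero) ∘ sym) (r≢t (flipˡ q)))}
      {nothing}
      {just (rest u (∉⇒≢ ox (suc (suc (suc zero))) ∘ sym) (~⇒≢ (~-sym tu) (adj-irr G t)))}
      (Adjacency.induced rs (trans (cong (adj G x u ∨_) tu) (Bool.∨-zeroʳ _))
        (cong₂ _∨_ x≁r (≁-sym rt)) ru (cong₂ _∨_ x≁s (≁-sym st)) su))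

  -- Some y is adjacent to x. By independence y lies in the core, so if x missed both r and s then y
  -- would be t or u, which `no-edge-to-t` forbids.
  touches-rs : ∀ {r s t u x} → Induced2K2 r s t u → Outside r s t u x → x ≁ r → x ~ s
  touches-rs {r} {s} {t} {u} {x} q ox x≁r = ¬≁⇒~ λ x≁s → impossible x≁s (no-isolated x)
    where
    impossible : x ≁ s → (∃ λ y → x ~ y) → ⊥
    impossible x≁s (y , x~y) with y ∈? (core r s t u)
    ... | no y∉                                   = ≁-¬~ x~y (independent q ox y∉)
    ... | yes (here refl)                         = ≁-¬~ x~y x≁r
    ... | yes (there (here refl))                 = ≁-¬~ x~y x≁s
    ... | yes (there (there (here refl)))         = no-edge-to-t q ox x≁r x≁s x~y
    ... | yes (there (there (there (here refl)))) = no-edge-to-t (flipʳ q) (out-flipʳ ox) x≁r x≁s x~y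

  touches-sr : ∀ {r s t u x} → Induced2K2 r s t u → Outside r s t u x → x ≁ s → x ~ r
  touches-sr q ox = touches-rs (flipˡ q) (out-flipˡ ox)

  touches-tu : ∀ {r s t u x} → Induced2K2 r s t u → Outside r s t u x → x ≁ t → x ~ u
  touches-tu q ox = touches-rs (swap q) (out-swap ox)

  touches-ut : ∀ {r s t u x} → Induced2K2 r s t u → Outside r s t u x → x ≁ u → x ~ t
  touches-ut q ox = touches-sr (swap q) (out-swap ox)

  -- Conflicting outside vertices

  module _ (¬C6 : ¬ (G ≅ C6)) (¬C6₁ : ¬ (G ≅ C6-one-chord)) (¬C6₂ : ¬ (G ≅ C6-two-chords))
           (¬G7 : ¬ (G ≅ G7)) where

    -- The order of the cycle, with s as x₀: the possible chords x₀x₂ and x₃x₅ are sx and uy.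
    hexagon : V G → V G → V G → V G → V G → V G → Vec (V G) 6
    hexagon s r x u t y = s ∷ r ∷ x ∷ u ∷ t ∷ y ∷ []

    module Conflict {r s t u x y : V G} (q : Induced2K2 r s t u) (ox : Outside r s t u x) (oy : Outside r s t u y)
                    (x~r : x ~ r) (x≁t : x ≁ t) (y~t : y ~ t) (y≁r : y ≁ r) where
      open Induced2K2 q

      x~u : x ~ u
      x~u = touches-tu q ox x≁t
      y~s : y ~ s
      y~s = touches-rs q oy y≁r
      x≁y : x ≁ y
      x≁y = independent q ox oy

      x≢r = ∉⇒≢ ox zero
      x≢s = ∉⇒≢ ox (suc zero)
      x≢u = ∉⇒≢ ox (suc (suc (suc zero)))
      y≢r = ∉⇒≢ oy zero
      y≢s = ∉⇒≢ oy (suc zero)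
      y≢t = ∉⇒≢ oy (suc (suc zero))
      y≢u = ∉⇒≢ oy (suc (suc (suc zero)))
      x≢y : x ≢ y
      x≢y = ~⇒≢ x~r y≁r
      r≢s : r ≢ s
      r≢s = ~⇒≢ r~s (adj-irr G s)
      t≢u : t ≢ u
      t≢u = ~⇒≢ t~u (adj-irr G u)

      xr-yt : Induced2K2 x r y t
      xr-yt = induced x~r y~t x≁y x≁t (≁-sym y≁r) r≁t

      Rest6 : V G → Set
      Rest6 z = z ∉ hexagon s r x u t y

      -- A seventh vertex z is outside both rs, tu and xr, yt. Since s and u are outside the latter,
      -- z misses them, hence z sees r and t; it misses x and y by independence. So its neighbours
      -- on the hexagon are exactly r and t.
      module Extra {z : V G} (oz : Rest6 z) where
        z≢s = ∉⇒≢ oz zero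
        z≢r = ∉⇒≢ oz (suc zero)
        z≢x = ∉⇒≢ oz (suc (suc zero))
        z≢u = ∉⇒≢ oz (suc (suc (suc zero)))
        z≢t = ∉⇒≢ oz (suc (suc (suc (suc zero))))
        z≢y = ∉⇒≢ oz (suc (suc (suc (suc (suc zero)))))

        z-out : Outside r s t u z
        z-out = ∉⁺ z≢r z≢s z≢t z≢u
        z-out′ : Outside x r y t z
        z-out′ = ∉⁺ z≢x z≢r z≢y z≢t
        z≁s : z ≁ s
        z≁s = independent xr-yt z-out′ (∉⁺ (x≢s ∘ sym) (r≢s ∘ sym) (y≢s ∘ sym) (r≢t (flipˡ q)))
        z≁u : z ≁ u
        z≁u = independent xr-yt z-out′
          (∉⁺ (x≢u ∘ sym) (r≢t (flipʳ q) ∘ sym) (y≢u ∘ sym) (t≢u ∘ sym))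
        z~r : z ~ r
        z~r = touches-sr q z-out z≁s
        z~t : z ~ t
        z~t = touches-ut q z-out z≁u
        z≁x : z ≁ x
        z≁x = independent q z-out ox
        z≁y : z ≁ y
        z≁y = independent q z-out oy

      cover : (∀ {z} → ¬ Rest6 z) → ∀ v → v ∈ hexagon s r x u t y
      cover none v with v ∈? (hexagon s r x u t y)
      ... | yes v∈ = v∈
      ... | no v∉  = ⊥-elim (none v∉)

      is-hexagon : ∀ {c d} → TwinFree (λ i j → c6e c d i j ∨ c6e c d j i) →
                   adj G s x ≡ c → adj G u y ≡ d → (∀ {z} → ¬ Rest6 z) →
                   G ≅ mkGraph (Fin 6) (c6e c d) (c6e-irr c d)
      is-hexagon {c} {d} tf sx uy none = twinFree-≅ (c6e c d) (c6e-irr c d) tf (hexagon s r x u t y) (cover none)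
        ( (~-sym r~s , trans sx (sym (Bool.∨-identityʳ c)) , s≁u , s≁t , ~-sym y~s , tt)
        , (~-sym x~r , r≁u , r≁t , ≁-sym y≁r , tt)
        , (x~u , x≁t , x≁y , tt)
        , (~-sym t~u , trans uy (sym (Bool.∨-identityʳ d)) , tt)
        , (~-sym y~t , tt)
        , tt , tt)

      -- Without chords, ys and xu induce a third 2K₂. A seventh vertex z would be outside it
      -- together with its neighbour r, so G is the bare hexagon.
      no-chord : x ≁ s → y ≁ u → ⊥
      no-chord x≁s y≁u = ¬C6 (is-hexagon
        (from-yes (twinFree? λ i j → c6e false false i j ∨ c6e false false j i))
        (≁-sym x≁s) (≁-sym y≁u) none)
        where
        ys-xu : Induced2K2 y s x u
        ys-xu = induced y~s x~u (≁-sym x≁y) y≁u (≁-sym x≁s) s≁u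
        none : ∀ {z} → ¬ Rest6 z
        none oz = ≁-¬~ z~r (independent ys-xu (∉⁺ z≢y z≢s z≢x z≢u)
          (∉⁺ (y≢r ∘ sym) r≢s (x≢r ∘ sym) (r≢t (flipʳ q))))
          where open Extra oz

      -- Independence outside this 2K₂ rules out the second chord yu when z exists, and rules out an
      -- eighth vertex, which would be adjacent to r.
      xs-zt : ∀ {z} → Rest6 z → x ~ s → Induced2K2 x s z t
      xs-zt oz x~s = induced x~s z~t (≁-sym z≁x) x≁t (≁-sym z≁s) s≁t
        where open Extra oz

      two-chords : x ~ s → y ~ u → ⊥
      two-chords x~s y~u = ¬C6₂ (is-hexagon
        (from-yes (twinFree? λ i j → c6e true true i j ∨ c6e true true j i))
        (~-sym x~s) (~-sym y~u) none)
        where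
        none : ∀ {z} → ¬ Rest6 z
        none oz = ≁-¬~ y~u (independent (xs-zt oz x~s)
          (∉⁺ (x≢y ∘ sym) y≢s (z≢y ∘ sym) y≢t)
          (∉⁺ (x≢u ∘ sym) (r≢t (flipˡ (flipʳ q)) ∘ sym) (z≢u ∘ sym) (t≢u ∘ sym)))
          where open Extra oz

      one-chord : x ~ s → y ≁ u → ⊥
      one-chord x~s y≁u = ¬C6₁ (is-hexagon
        (from-yes (twinFree? λ i j → c6e true false i j ∨ c6e true false j i))
        (~-sym x~s) (≁-sym y≁u) none)
        where
        none : ∀ {z} → ¬ Rest6 z
        none {z} oz = ¬G7 (twinFree-≅ g7e g7e-irr (from-yes (twinFree? λ i j → g7e i j ∨ g7e j i))
          -- In graph (4) the two core edges are exchanged: t, u, r, s here play its r, s, t, u,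
          -- while y, z, x play its v, w, x.
          (t ∷ u ∷ r ∷ s ∷ y ∷ z ∷ x ∷ []) cover7
          ( (t~u , ≁-sym r≁t , ≁-sym s≁t , ~-sym y~t , ~-sym z~t , ≁-sym x≁t , tt)
          , (≁-sym r≁u , ≁-sym s≁u , ≁-sym y≁u , ≁-sym z≁u , ~-sym x~u , tt)
          , (r~s , ≁-sym y≁r , ~-sym z~r , ~-sym x~r , tt)
          , (~-sym y~s , ≁-sym z≁s , ~-sym x~s , tt)
          , (≁-sym z≁y , ≁-sym x≁y , tt)
          , (z≁x , tt)
          , tt , tt))
          where
          open Extra oz
          cover7 : ∀ v → v ∈ t ∷ u ∷ r ∷ s ∷ y ∷ z ∷ x ∷ []
          cover7 v with v ∈? (t ∷ u ∷ r ∷ s ∷ y ∷ z ∷ x ∷ [])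
          ... | yes v∈ = v∈
          ... | no v∉  = ⊥-elim (≁-¬~ (Extra.z~r ov) (independent (xs-zt oz x~s)
            (∉⁺ (Extra.z≢x ov) (Extra.z≢s ov) (∉⇒≢ v∉ (suc (suc (suc (suc (suc zero)))))) (Extra.z≢t ov))
            (∉⁺ (x≢r ∘ sym) r≢s (z≢r ∘ sym) (r≢t q))))
            where
            ov : Rest6 v
            ov (here e)                                         = ∉⇒≢ v∉ (suc (suc (suc zero))) e
            ov (there (here e))                                 = ∉⇒≢ v∉ (suc (suc zero)) e
            ov (there (there (here e)))                         = ∉⇒≢ v∉ (suc (suc (suc (suc (suc (suc zero)))))) e
            ov (there (there (there (here e))))                 = ∉⇒≢ v∉ (suc zero) e
            ov (there (there (there (there (here e)))))         = ∉⇒≢ v∉ zero e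
            ov (there (there (there (there (there (here e)))))) = ∉⇒≢ v∉ (suc (suc (suc (suc zero)))) e

    no-conflict : ∀ {r s t u x y} → Induced2K2 r s t u → Outside r s t u x → Outside r s t u y →
                  x ~ r → x ≁ t → y ~ t → y ≁ r → ⊥
    no-conflict {r} {s} {t} {u} {x} {y} q ox oy x~r x≁t y~t y≁r with adj? x s | adj? y u
    ... | inj₂ x≁s | inj₂ y≁u = Conflict.no-chord q ox oy x~r x≁t y~t y≁r x≁s y≁u
    ... | inj₁ x~s | inj₂ y≁u = Conflict.one-chord q ox oy x~r x≁t y~t y≁r x~s y≁u
    -- Exchanging rs with tu and x with y turns the chord yu into the chord xs.
    ... | inj₂ x≁s | inj₁ y~u = Conflict.one-chord (swap q) (out-swap oy) (out-swap ox) y~t y≁r x~r x≁t y~u x≁s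
    ... | inj₁ x~s | inj₁ y~u = Conflict.two-chords q ox oy x~r x≁t y~t y≁r x~s y~u

    -- Conflict-free case: reduction to the two families

    module _ (¬F5 : ∀ a b c → ¬ (G ≅ F5 a b c)) (¬F6 : ∀ a b c d → ¬ (G ≅ F6 a b c d)) where

      not-in-F5 : ∀ {r s t u} → Induced2K2 r s t u →
                  (∀ {x} → Outside r s t u x → x ~ t × x ~ u) → ⊥
      not-in-F5 q full =
        let a , b , c , φ = Families.in-F5 G finite q (independent q) (touches-rs q) full in ¬F5 a b c φ

      not-in-F6 : ∀ {r s t u} → Induced2K2 r s t u → (∀ {x} → Outside r s t u x → x ~ s) →
                  (∀ {x} → Outside r s t u x → x ~ r → x ~ t × x ~ u) → ⊥
      not-in-F6 q centre full =
        let a , b , c , d , φ = Families.in-F6 G finite q (independent q) (touches-tu q) centre full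
        in ¬F6 a b c d φ

      no-rsu : ∀ {r s t u x} → Induced2K2 r s t u → Outside r s t u x →
               x ~ r → x ~ s → x ≁ t → ⊥
      no-rsu {r} {s} {t} {u} {x} q ox x~r x~s x≁t =
        -- After `swap`, u is the common neighbour of family (6) and t takes the place of r;
        -- `no-rst` shows that no outside vertex misses u.
        not-in-F6 (swap q) (λ oy → ¬≁⇒~ (no-rst (out-swap oy))) (λ oy → t⇒rs (out-swap oy))
        where
        t⇒rs : ∀ {y} → Outside r s t u y → y ~ t → y ~ r × y ~ s
        t⇒rs oy y~t = ¬≁⇒~ (no-conflict q ox oy x~r x≁t y~t) ,
                      ¬≁⇒~ (no-conflict (flipˡ q) (out-flipˡ ox) (out-flipˡ oy) x~s x≁t y~t)

        no-rst : ∀ {y} → Outside r s t u y → y ≁ u → ⊥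
        no-rst {y} oy y≁u = not-in-F5 (swap q) (λ oz → rs (out-swap oz))
          where
          y~rs : y ~ r × y ~ s
          y~rs = t⇒rs oy (touches-ut q oy y≁u)

          rs : ∀ {z} → Outside r s t u z → z ~ r × z ~ s
          rs {z} oz with adj? z t
          ... | inj₁ z~t = t⇒rs oz z~t
          -- Here z sees u, while y misses u and sees r and s. If z missed r or s, then y and z
          -- would conflict.
          ... | inj₂ z≁t =
            ¬≁⇒~ (no-conflict (flipʳ q) (out-flipʳ oy) (out-flipʳ oz) (proj₁ y~rs) y≁u z~u) ,
            ¬≁⇒~ (no-conflict (flipˡ (flipʳ q)) (out-flipˡ (out-flipʳ oy)) (out-flipˡ (out-flipʳ oz))
                     (proj₂ y~rs) y≁u z~u)
            where
            z~u : z ~ u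
            z~u = touches-tu q oz z≁t

      -- An outside neighbour of r also sees s, so by `no-rsu` and its mirror image it misses
      -- neither t nor u: this is family (6).
      no-centre : ∀ {r s t u} → Induced2K2 r s t u → (∀ {x} → Outside r s t u x → x ~ s) → ⊥
      no-centre q centre = not-in-F6 q centre λ ox x~r →
        ¬≁⇒~ (no-rsu q ox x~r (centre ox)) ,
        ¬≁⇒~ (no-rsu (flipʳ q) (out-flipʳ ox) x~r (centre ox))

      -- Absence of conflicts carries non-adjacency over: if z sees r then x misses t, if z sees s
      -- then y misses t, and likewise for w and u. If z and w both see r, then x misses tu; if both
      -- miss r, they see s and y misses tu. In the mixed cases x and y conflict over s and one of
      -- t, u.
      centre-exists : ∀ {r s t u x y z w} → Induced2K2 r s t u →
                      Outside r s t u x → Outside r s t u y → Outside r s t u z → Outside r s t u w →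
                      x ≁ r → y ≁ s → z ≁ t → w ≁ u → ⊥
      centre-exists {r} {s} {t} {u} {x} {y} {z} {w} q ox oy oz ow x≁r y≁s z≁t w≁u =
        impossible (adj? z r) (adj? w r)
        where
        z~r⇒x≁t : z ~ r → x ≁ t
        z~r⇒x≁t z~r = ¬~⇒≁ λ x~t → no-conflict q oz ox z~r z≁t x~t x≁r
        z~s⇒y≁t : z ~ s → y ≁ t
        z~s⇒y≁t z~s = ¬~⇒≁ λ y~t → no-conflict (flipˡ q) (out-flipˡ oz) (out-flipˡ oy) z~s z≁t y~t y≁s
        w~r⇒x≁u : w ~ r → x ≁ u
        w~r⇒x≁u w~r = ¬~⇒≁ λ x~u → no-conflict (flipʳ q) (out-flipʳ ow) (out-flipʳ ox) w~r w≁u x~u x≁r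
        w~s⇒y≁u : w ~ s → y ≁ u
        w~s⇒y≁u w~s = ¬~⇒≁ λ y~u → no-conflict (flipˡ (flipʳ q)) (out-flipˡ (out-flipʳ ow))
                                      (out-flipˡ (out-flipʳ oy)) w~s w≁u y~u y≁s
        x~s : x ~ s
        x~s = touches-rs q ox x≁r

        impossible : z ~ r ⊎ z ≁ r → w ~ r ⊎ w ≁ r → ⊥
        impossible (inj₁ z~r) (inj₁ w~r) = ≁-¬~ (touches-tu q ox (z~r⇒x≁t z~r)) (w~r⇒x≁u w~r)
        impossible (inj₂ z≁r) (inj₂ w≁r) =
          ≁-¬~ (touches-tu q oy (z~s⇒y≁t (touches-rs q oz z≁r))) (w~s⇒y≁u (touches-rs q ow w≁r))
        impossible (inj₁ z~r) (inj₂ w≁r) =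
          no-conflict (flipˡ q) (out-flipˡ ox) (out-flipˡ oy) x~s (z~r⇒x≁t z~r)
            (touches-ut q oy (w~s⇒y≁u (touches-rs q ow w≁r))) y≁s
        impossible (inj₂ z≁r) (inj₁ w~r) =
          no-conflict (flipˡ (flipʳ q)) (out-flipˡ (out-flipʳ ox)) (out-flipˡ (out-flipʳ oy)) x~s (w~r⇒x≁u w~r)
            (touches-tu q oy (z~s⇒y≁t (touches-rs q oz z≁r))) y≁s

      no-induced : ∀ {r s t u} → Induced2K2 r s t u → ⊥
      no-induced q =
        -- Refuting r, s, t, u in turn as common neighbours replaces a search: each layer assumes an
        -- outside vertex missing the current one, and these four vertices feed `centre-exists`.
        no-centre (flipˡ q) λ ox → ¬≁⇒~ λ x≁r →
        no-centre q λ oy → ¬≁⇒~ λ y≁s →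
        no-centre (flipˡ (swap q)) λ oz → ¬≁⇒~ λ z≁t →
        no-centre (swap q) λ ow → ¬≁⇒~ λ w≁u →
        centre-exists q (out-flipˡ ox) oy (out-swap (out-flipˡ oz)) (out-swap ow) x≁r y≁s z≁t w≁u

theorem25 : (G : Graph) → Finite G → NoIsolated G
    → ¬ (G ≅ C6) → ¬ (G ≅ C6-one-chord) → ¬ (G ≅ C6-two-chords) → ¬ (G ≅ G7)
    → (∀ a b c → ¬ (G ≅ F5 a b c))
    → (∀ a b c d → ¬ (G ≅ F6 a b c d))
    → (2K2-free G ⇔ (∀ (u v : V G) → adj G u v ≡ true → 2K2-free (contract G u v)))
theorem25 G (n , finite) no-isolated ¬C6 ¬C6₁ ¬C6₂ ¬G7 ¬F5 ¬F6 = mk⇔ (contract-2K2-free G) backward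
  where
  backward : (∀ (u v : V G) → adj G u v ≡ true → 2K2-free (contract G u v)) → 2K2-free G
  backward free has with Adjacency.has⇒induced G has
  ... | _ , _ , _ , _ , q =
    Irreducible.no-induced G finite no-isolated free ¬C6 ¬C6₁ ¬C6₂ ¬G7 ¬F5 ¬F6 q
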